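{- Let $k\ge 1$, $n\ge 2$ and $\mathbf C=(c_0,\dots,c_k)\in\{0,1\}^{k+1}$. Let $\mathbf H_n=(h_0,\dots,h_k)$ with $h_\beta=\binom{k}{\beta}\sum_{j=1}^{n-1}\frac{1}{j^\beta}$, and $\mathbf H_n\mathbf C^T=\sum_{\beta=0}^k h_\beta c_\beta$. For $1\le m\le n$ define $$O_{\mathbf C\max}(n,m+c_k-1)=\frac{(n-1)!^k}{(m-1)!}\,(\mathbf H_n\mathbf C^T)^{m-1}\prod_{i=1}^{n-m}F_{i+1}(\mathbf C').$$ Then $O_{\mathbf C\max}(n,m+c_k-1)\ge O_{\mathbf C}(n,m+c_k-1)$ for all $1\le m\le n$.
   Context: Fix integers $k\ge 1$, $n\ge 1$ and $\mathbf C=(c_0,c_1,\dots,c_k)\in\{0,1\}^{k+1}$; put $\mathbf C'=(1,\dots,1)-\mathbf C$. Consider $k$-tuples $(\pi_1,\dots,\pi_k)$ of permutations of $\{1,\dots,n\}$. A position $\alpha$ is a record of a permutation $\pi$ if $\pi(\alpha)<\pi(\alpha')$ for every $\alpha'<\alpha$ (position $1$ is always a record); equivalently records index the minimal elements of the points $(\alpha,\pi(\alpha))$ under strict componentwise domination. For a tuple, let $l_\alpha$ be the number of $\beta\in\{1,\dots,k\}$ for which $\alpha$ is a record of $\pi_\beta$ (so $l_1=k$). The $\mathbf C$ sequential optimization set of the tuple is $S=\{\alpha:c_{l_\alpha}=1\}$, with weight $|S|$. For an integer $m$, $O_{\mathbf C}(n,m)$ is the number of $k$-tuples whose weight equals $m$.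 For $j\ge 2$ and $X=(x_0,\dots,x_k)\in\mathbb R^{k+1}$, $F_j(X)=\sum_{\beta=0}^k\binom{k}{\beta}\frac{x_\beta}{(j-1)^\beta}$. Empty products equal $1$. -}

module Defs where

open import Data.Fin.Base as Fin using (Fin; zero; suc; toℕ; fromℕ<)
open import Data.Fin.Properties as Fin using (all?)
open import Data.Fin.Subset using (Subset; ∣_∣)
open import Data.Integer.Base using (+_)
open import Data.List.Base as List using (List; allFin; cartesianProductWith; filter; length)
open import Data.Nat.Base as ℕ using (ℕ; zero; suc; NonZero; _∸_; _!; s≤s)
open import Data.Nat.Combinatorics using () renaming (_C_ to _choose_)
open import Data.Nat.Properties as ℕ using (m^n≢0; _!≢0)
open import Data.Rational.Base using (ℚ; 1ℚ; _/_; _*_; _-_; +-*-rawSemiring)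
open import Data.Vec.Base using (Vec; []; _∷_; lookup; count; tabulate)
open import Data.Vec.Properties using (count≤n)
open import Data.Vec.Functional using (Vector)
open import Data.Vec.Relation.Unary.AllPairs using (allPairs?)
open import Data.Vec.Relation.Unary.Unique.Propositional using (Unique)
open import Relation.Nullary.Decidable using (Dec; does; ¬?; _→-dec_)

open import Algebra.Definitions.RawSemiring +-*-rawSemiring using (sum; product; _^_)

-- If the given list contains each letter exactly once, the result contains
-- each word of length n exactly once.
words : ∀ {A : Set} → List A → (n : ℕ) → List (Vec A n)
words as zero    = [] List.∷ List.[]
words as (suc n) = cartesianProductWith _∷_ as (words as n)

unique? : ∀ {m n} (w : Vec (Fin m) n) → Dec (Unique w)
unique? = allPairs? λ x y → ¬? (x Fin.≟ y)

-- Permutations of {1,…,n} in one-line notation: the words of length n over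
-- Fin n without repeated letter.  Positions and values are shifted to start
-- at 0, so position 1 is zero.
permutations : (n : ℕ) → List (Vec (Fin n) n)
permutations n = filter unique? (words (allFin n) n)

tuples : (k n : ℕ) → List (Vec (Vec (Fin n) n) k)
tuples k n = words (permutations n) k

IsRecord : ∀ {n} → Fin n → Vec (Fin n) n → Set
IsRecord α π = ∀ α′ → α′ Fin.< α → lookup π α Fin.< lookup π α′

isRecord? : ∀ {n} (α : Fin n) (π : Vec (Fin n) n) → Dec (IsRecord α π)
isRecord? α π = all? λ α′ → (α′ Fin.<? α) →-dec (lookup π α Fin.<? lookup π α′)

-- l_α, bounded by k so that it can index (c₀,…,c_k)
recordCount : ∀ {k n} → Vec (Vec (Fin n) n) k → Fin n → Fin (suc k)
recordCount πs α = fromℕ< (s≤s (count≤n (isRecord? α) πs))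

optimizationSet : ∀ {k n} → Vector (Fin 2) (suc k) → Vec (Vec (Fin n) n) k → Subset n
optimizationSet c πs = tabulate λ α → does (c (recordCount πs α) Fin.≟ suc zero)

weight : ∀ {k n} → Vector (Fin 2) (suc k) → Vec (Vec (Fin n) n) k → ℕ
weight c πs = ∣ optimizationSet c πs ∣

O : ∀ {k} → Vector (Fin 2) (suc k) → (n m : ℕ) → ℕ
O {k} c n m = length (filter (λ πs → weight c πs ℕ.≟ m) (tuples k n))

fromℕℚ : ℕ → ℚ
fromℕℚ a = + a / 1

invPow : (d : ℕ) .{{_ : NonZero d}} → ℕ → ℚ
invPow d β = _/_ (+ 1) (d ℕ.^ β) {{m^n≢0 d β}}

toℚ : ∀ {k} → Vector (Fin 2) (suc k) → Vector ℚ (suc k)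
toℚ c β = fromℕℚ (toℕ (c β))

complement : ∀ {k} → Vector ℚ (suc k) → Vector ℚ (suc k)
complement x β = 1ℚ - x β

-- The instance argument says j ≥ 2.
F : ∀ {k} (j : ℕ) .{{_ : NonZero (j ∸ 1)}} → Vector ℚ (suc k) → ℚ
F {k} j x = sum λ β → fromℕℚ (k choose toℕ β) * (x β * invPow (j ∸ 1) (toℕ β))

-- In H and Omax, the index t : Fin _ encodes the 1-based index 1 + t.
H : (k n : ℕ) → Vector ℚ (suc k)
H k n β = fromℕℚ (k choose toℕ β) * sum {n ∸ 1} λ t → invPow (suc (toℕ t)) (toℕ β)

_·_ : ∀ {k} → Vector ℚ (suc k) → Vector ℚ (suc k) → ℚ
x · y = sum λ β → x β * y β

-- Omax c n m is the bound O_{C max}(n , m + c_k - 1): its last argument is the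
-- parameter m of the defining formula, not the weight m + c_k - 1.
Omax : ∀ {k} → Vector (Fin 2) (suc k) → (n m : ℕ) → ℚ
Omax {k} c n m =
  _/_ (+ (((n ∸ 1) !) ℕ.^ k)) ((m ∸ 1) !) {{(m ∸ 1) !≢0}}
  * (H k n · toℚ c) ^ (m ∸ 1)
  * product {n ∸ m} λ t → F (suc (suc (toℕ t))) (complement (toℚ c))

{-# OPTIONS --safe #-}

-- A permutation is built by appending its last letter v and relabelling the
-- others; this keeps the earlier records, and the new position is a record iff
-- v is minimal.  Among the j^k choices of last letters for a k-tuple, a number
-- binom(k,l) (j-1)^(k-l) create l records, so the weight enumerator is
--   x^{c_k} ∏_{j=2}^n (j-1)^k (F_j(C') + F_j(C) x).
-- Since F_j(C') is nonincreasing in j, the n - m factors F_j(C') in any term of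
-- the coefficient of x^{m-1+c_k} are dominated by those with j = 2, …, n-m+1.
-- What remains is the elementary symmetric polynomial of degree m-1 in the
-- F_j(C), at most (∑_j F_j(C))^{m-1} / (m-1)!, and ∑_j F_j(C) = H_n C^T.
module Submission where

open import Defs
open import Algebra.Bundles using (CommutativeRing)
import Algebra.Properties.CommutativeMonoid.Sum as CommutativeMonoidSum
import Algebra.Properties.CommutativeSemiring.Exp as CommutativeSemiringExp
import Algebra.Properties.Monoid.Sum as MonoidSum
import Algebra.Properties.Semiring.Sum as SemiringSum
open import Data.Bool.Base using (Bool; true; false; if_then_else_)
open import Data.Fin.Base as Fin using (Fin; zero; suc; toℕ; fromℕ; inject₁; punchIn; punchOut)
open import Data.Fin.Properties as Fin using (toℕ-injective; toℕ-inject₁; toℕ-fromℕ; toℕ-fromℕ<)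
open import Data.Fin.Relation.Unary.Top using (view; ‵fromℕ; ‵inject₁)
open import Data.Fin.Subset using (∣_∣)
open import Data.Integer.Base as ℤ using (+_)
import Data.Integer.Properties as ℤ
open import Data.List.Base as List using (List; allFin; cartesianProductWith; filter; length)
open import Data.List.Membership.Propositional using (_∈_)
open import Data.List.Membership.Propositional.Properties using (∈-∃++; ∈-++⁻; ∈-++⁺ˡ; ∈-++⁺ʳ; ∈-filter⁺; ∈-filter⁻; ∈-cartesianProductWith⁺; ∈-cartesianProductWith⁻; ∈-allFin)
open import Data.List.Properties using (length-++-sucʳ)
open import Data.List.Relation.Binary.Subset.Propositional using (_⊆_)
import Data.List.Relation.Unary.All as ListAll
import Data.List.Relation.Unary.AllPairs as ListAllPairs
open import Data.List.Relation.Unary.Any using (here; there)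
import Data.List.Relation.Unary.Unique.Propositional as List
import Data.List.Relation.Unary.Unique.Propositional.Properties as List
open import Data.Nat.Base as ℕ using (ℕ; zero; suc; _≡ᵇ_; _∸_; _!; NonZero; z≤n; s≤s)
open import Data.Nat.Combinatorics using (nCk+nC[k+1]≡[n+1]C[k+1]; k>n⇒nCk≡0) renaming (_C_ to _choose_)
import Data.Nat.Properties as ℕ
open import Data.Product.Base using (∃₂; ∃-syntax; _×_; _,_; proj₂)
open import Data.Rational.Base hiding (NonZero; ∣_∣)
open import Data.Rational.Properties as ℚ
open import Data.Rational.Solver using (module +-*-Solver)
open import Data.Rational.Unnormalised.Base as ℚᵘ using (mkℚᵘ; *≡*; *≤*)
import Data.Rational.Unnormalised.Properties as ℚᵘ
open import Data.Sum.Base using (inj₁; inj₂)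
open import Data.Vec.Base using (Vec; []; _∷_; _∷ʳ_; lookup; map; tabulate; zipWith; replicate; count)
open import Data.Vec.Functional using (Vector)
open import Data.Vec.Properties using (∷-injective; lookup-map; lookup∘tabulate; tabulate∘lookup; tabulate-cong)
open import Data.Vec.Relation.Unary.All as All using (All; []; _∷_)
open import Data.Vec.Relation.Unary.Unique.Propositional using (Unique)
open import Data.Vec.Relation.Unary.Unique.Propositional.Properties using (lookup-injective; tabulate⁺)
open import Function.Base using (_∘_; _$_)
open import Function.Bundles using (_⇔_; mk⇔)
open import Relation.Binary.PropositionalEquality using (_≡_; _≢_; refl; sym; trans; cong; cong₂; subst; subst₂; module ≡-Reasoning)
open import Relation.Nullary.Decidable using (does; does-⇔; dec-true; dec-false)
open import Relation.Nullary.Negation using (¬_; contradiction)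
open import Relation.Unary using (Decidable)

open import Algebra.Definitions.RawSemiring +-*-rawSemiring using (sum; product; _^_)
open CommutativeMonoidSum +-0-commutativeMonoid using (sum-cong-≗; sum-init-last; ∑-distrib-+; ∑-comm)
open CommutativeSemiringExp (CommutativeRing.commutativeSemiring +-*-commutativeRing) using (^-distrib-*)
open MonoidSum *-1-monoid using () renaming (sum-init-last to product-init-last; sum-cong-≗ to product-cong-≗)
open SemiringSum (CommutativeRing.semiring +-*-commutativeRing) using (*-distribˡ-sum)
open +-*-Solver using (solve; _:+_; _:*_; _:-_; con; _:=_)

-- Tuples of permutations by their last letters

-- Induction on `xs`: deleting one occurrence of the head from `ys` leaves a list that still
-- contains the tail, because the head does not recur there. This compares sizes without a
-- bijection.
unique-⊆⇒length≤ : ∀ {A : Set} {xs ys : List A} → List.Unique xs → xs ⊆ ys → length xs ℕ.≤ length ys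
unique-⊆⇒length≤ {xs = List.[]} _ _ = z≤n
unique-⊆⇒length≤ {xs = x List.∷ xs} (x∉xs ListAllPairs.∷ xs!) xs⊆ys with ∈-∃++ (xs⊆ys (here refl))
... | as , bs , refl = subst (suc (length xs) ℕ.≤_) (sym (length-++-sucʳ as x bs))
                         (s≤s (unique-⊆⇒length≤ xs! xs⊆as++bs))
  where
  xs⊆as++bs : xs ⊆ as List.++ bs
  xs⊆as++bs z∈xs with ∈-++⁻ as (xs⊆ys (there z∈xs))
  ... | inj₁ z∈as           = ∈-++⁺ˡ z∈as
  ... | inj₂ (here z≡x)     = contradiction (sym z≡x) (ListAll.lookup x∉xs z∈xs)
  ... | inj₂ (there z∈bs)   = ∈-++⁺ʳ as z∈bs

words-unique : ∀ {A : Set} {as : List A} → List.Unique as → ∀ n → List.Unique (words as n)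
words-unique as! zero    = ListAll.[] ListAllPairs.∷ ListAllPairs.[]
words-unique as! (suc n) = List.cartesianProductWith⁺ _∷_ ∷-injective as! (words-unique as! n)

∈-words⁺ : ∀ {A : Set} {as : List A} → (∀ a → a ∈ as) → ∀ {n} (w : Vec A n) → w ∈ words as n
∈-words⁺ all∈ []      = here refl
∈-words⁺ all∈ (a ∷ w) = ∈-cartesianProductWith⁺ _∷_ (all∈ a) (∈-words⁺ all∈ w)

∈-words⁻ : ∀ {A : Set} (as : List A) n {w} → w ∈ words as n → All (_∈ as) w
∈-words⁻ as zero    (here refl) = []
∈-words⁻ as (suc n) w∈ with ∈-cartesianProductWith⁻ _∷_ as (words as n) w∈
... | a , w , a∈as , w∈words , refl = a∈as ∷ ∈-words⁻ as n w∈words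

snoc : ∀ {n} → Fin (suc n) → Vec (Fin n) n → Vec (Fin (suc n)) (suc n)
snoc v π = map (punchIn v) π ∷ʳ v

lookup-∷ʳ-inject₁ : ∀ {A : Set} {n} (xs : Vec A n) x i → lookup (xs ∷ʳ x) (inject₁ i) ≡ lookup xs i
lookup-∷ʳ-inject₁ (_ ∷ xs) x zero    = refl
lookup-∷ʳ-inject₁ (_ ∷ xs) x (suc i) = lookup-∷ʳ-inject₁ xs x i

lookup-∷ʳ-fromℕ : ∀ {A : Set} {n} (xs : Vec A n) x → lookup (xs ∷ʳ x) (fromℕ n) ≡ x
lookup-∷ʳ-fromℕ []       x = refl
lookup-∷ʳ-fromℕ (_ ∷ xs) x = lookup-∷ʳ-fromℕ xs x

lookup-snoc-inject₁ : ∀ {n} v (π : Vec (Fin n) n) i → lookup (snoc v π) (inject₁ i) ≡ punchIn v (lookup π i)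
lookup-snoc-inject₁ v π i = trans (lookup-∷ʳ-inject₁ (map (punchIn v) π) v i) (lookup-map i (punchIn v) π)

lookup-snoc-fromℕ : ∀ {n} v (π : Vec (Fin n) n) → lookup (snoc v π) (fromℕ n) ≡ v
lookup-snoc-fromℕ v π = lookup-∷ʳ-fromℕ (map (punchIn v) π) v

lookup-ext : ∀ {A : Set} {n} {xs ys : Vec A n} → (∀ i → lookup xs i ≡ lookup ys i) → xs ≡ ys
lookup-ext {xs = xs} {ys} eq = begin
  xs                   ≡⟨ tabulate∘lookup xs ⟨
  tabulate (lookup xs) ≡⟨ tabulate-cong eq ⟩
  tabulate (lookup ys) ≡⟨ tabulate∘lookup ys ⟩
  ys                   ∎
  where open ≡-Reasoning

-- The last letter `v` differs from all others, so `punchOut` closes the gap at `v` and `punchIn v`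
-- reopens it. This surjectivity of `snoc` onto words without repetition puts every tuple of
-- permutations into `codes`.
unsnoc : ∀ {n} {w : Vec (Fin (suc n)) (suc n)} → Unique w → ∃₂ λ v π → Unique π × w ≡ snoc v π
unsnoc {n} {w} w! = v , π , tabulate⁺ π-injective , lookup-ext w≗snoc
  where
  v = lookup w (fromℕ n)

  v≢ : ∀ i → v ≢ lookup w (inject₁ i)
  v≢ i eq = Fin.fromℕ≢inject₁ (lookup-injective w! (fromℕ n) (inject₁ i) eq)

  π = tabulate λ i → punchOut (v≢ i)

  π-injective : ∀ {i j} → punchOut (v≢ i) ≡ punchOut (v≢ j) → i ≡ j
  π-injective {i} {j} eq =
    Fin.inject₁-injective (lookup-injective w! _ _ (Fin.punchOut-injective (v≢ i) (v≢ j) eq))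

  w≗snoc : ∀ i → lookup w i ≡ lookup (snoc v π) i
  w≗snoc i with view i
  ... | ‵fromℕ     = sym (lookup-snoc-fromℕ v π)
  ... | ‵inject₁ j = sym $ begin
    lookup (snoc v π) (inject₁ j)  ≡⟨ lookup-snoc-inject₁ v π j ⟩
    punchIn v (lookup π j)         ≡⟨ cong (punchIn v) (lookup∘tabulate _ j) ⟩
    punchIn v (punchOut (v≢ j))    ≡⟨ Fin.punchIn-punchOut (v≢ j) ⟩
    lookup w (inject₁ j)           ∎
    where open ≡-Reasoning

unsnocs : ∀ {k n} {ws : Vec (Vec (Fin (suc n)) (suc n)) k} → All Unique ws →
          ∃₂ λ vs πs → All Unique πs × ws ≡ zipWith snoc vs πs
unsnocs []         = [] , [] , [] , refl
unsnocs (w! ∷ ws!) with unsnoc w! | unsnocs ws!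
... | v , π , π! , refl | vs , πs , πs! , refl = v ∷ vs , π ∷ πs , π! ∷ πs! , refl

-- An overcount of tuples k (suc n) suffices for an upper bound, so it is never
-- shown that codes contains only permutations.
codes : (k n : ℕ) → List (Vec (Vec (Fin (suc n)) (suc n)) k)
codes k zero    = replicate k (zero ∷ []) List.∷ List.[]
codes k (suc n) = cartesianProductWith (zipWith snoc) (words (allFin (suc (suc n))) k) (codes k n)

Fin1-words : ∀ {k} (ws : Vec (Vec (Fin 1) 1) k) → ws ≡ replicate k (zero ∷ [])
Fin1-words []                = refl
Fin1-words ((zero ∷ []) ∷ ws) = cong ((zero ∷ []) ∷_) (Fin1-words ws)

∈-codes : ∀ {k} n {ws : Vec (Vec (Fin (suc n)) (suc n)) k} → All Unique ws → ws ∈ codes k n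
∈-codes zero    {ws} _ = here (Fin1-words ws)
∈-codes (suc n) ws! with unsnocs ws!
... | vs , πs , πs! , refl = ∈-cartesianProductWith⁺ (zipWith snoc) (∈-words⁺ ∈-allFin vs) (∈-codes n πs!)

tuples-unique : ∀ k n → List.Unique (tuples k n)
tuples-unique k n = words-unique (List.filter⁺ unique? (words-unique (List.allFin⁺ n) n)) k

tuples⊆codes : ∀ k n → tuples k (suc n) ⊆ codes k n
tuples⊆codes k n πs∈ =
  ∈-codes n (All.map (λ {π} π∈ → proj₂ (∈-filter⁻ unique? {xs = words (allFin (suc n)) (suc n)} π∈))
                     (∈-words⁻ (permutations (suc n)) k πs∈))

-- `tuples` is free of repetitions and contained in `codes`, and filtering by weight preserves both
-- facts.
O≤length-codes : ∀ {k} c n m → O c (suc n) m ℕ.≤ length (filter (λ πs → weight c πs ℕ.≟ m) (codes k n))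
O≤length-codes {k} c n m = unique-⊆⇒length≤ (List.filter⁺ weight≟m (tuples-unique k (suc n))) sub
  where
  weight≟m = λ πs → weight c πs ℕ.≟ m
  sub : filter weight≟m (tuples k (suc n)) ⊆ filter weight≟m (codes k n)
  sub πs∈ with ∈-filter⁻ weight≟m {xs = tuples k (suc n)} πs∈
  ... | πs∈tuples , weight≡m = ∈-filter⁺ weight≟m (tuples⊆codes k n πs∈tuples) weight≡m

-- Records and weights after appending last letters

punchIn-mono-< : ∀ {n} i {j k : Fin n} → j Fin.< k → punchIn i j Fin.< punchIn i k
punchIn-mono-< i {j} {k} j<k = ℕ.≰⇒> λ le → ℕ.<⇒≱ j<k (Fin.punchIn-cancel-≤ i k j le)

punchIn-cancel-< : ∀ {n} i {j k : Fin n} → punchIn i j Fin.< punchIn i k → j Fin.< k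
punchIn-cancel-< i {j} {k} lt = ℕ.≰⇒> λ le → ℕ.<⇒≱ lt (Fin.punchIn-mono-≤ i k j le)

inject₁<fromℕ : ∀ {n} (i : Fin n) → inject₁ i Fin.< fromℕ n
inject₁<fromℕ {n} i = subst (toℕ (inject₁ i) ℕ.<_) (sym (toℕ-fromℕ n)) (Fin.inject₁ℕ< i)

-- `punchIn v` preserves and reflects the strict order, and the appended position lies after every
-- old one, so it enters no old record condition.
IsRecord-snoc-inject₁ : ∀ {n} v (π : Vec (Fin n) n) α →
                        IsRecord (inject₁ α) (snoc v π) ⇔ IsRecord α π
IsRecord-snoc-inject₁ v π α = mk⇔ to from
  where
  to : IsRecord (inject₁ α) (snoc v π) → IsRecord α π
  to r α′ α′<α = punchIn-cancel-< v
    (subst₂ Fin._<_ (lookup-snoc-inject₁ v π α) (lookup-snoc-inject₁ v π α′)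
      (r (inject₁ α′) (subst₂ ℕ._<_ (sym (toℕ-inject₁ α′)) (sym (toℕ-inject₁ α)) α′<α)))

  from : IsRecord α π → IsRecord (inject₁ α) (snoc v π)
  from r α′ α′<α with view α′
  ... | ‵fromℕ     = contradiction (Fin.≤fromℕ (inject₁ α)) (ℕ.<⇒≱ α′<α)
  ... | ‵inject₁ β =
    subst₂ Fin._<_ (sym (lookup-snoc-inject₁ v π α)) (sym (lookup-snoc-inject₁ v π β))
      (punchIn-mono-< v (r β (subst₂ ℕ._<_ (toℕ-inject₁ β) (toℕ-inject₁ α) α′<α)))

IsRecord-snoc-zero : ∀ {n} (π : Vec (Fin n) n) → IsRecord (fromℕ n) (snoc zero π)
IsRecord-snoc-zero {n} π α′ α′<α with view α′
... | ‵fromℕ     = contradiction α′<α (ℕ.<-irrefl refl)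
-- `punchIn zero` is `suc`, so every earlier letter is positive.
... | ‵inject₁ β = subst₂ Fin._<_ (sym (lookup-snoc-fromℕ zero π)) (sym (lookup-snoc-inject₁ zero π β)) (s≤s z≤n)

-- All that is needed of a permutation π to know that a last letter v ≠ zero is
-- not a record of snoc v π.
HasZero : ∀ {n} → Vec (Fin (suc n)) (suc n) → Set
HasZero π = ∃[ i ] lookup π i ≡ zero

-- A last letter `zero` is itself the witness; a last letter `suc v` keeps the old witness, since
-- `punchIn (suc v)` fixes `zero`.
HasZero-snoc : ∀ {n} v {π : Vec (Fin (suc n)) (suc n)} → HasZero π → HasZero (snoc v π)
HasZero-snoc zero    {π} _        = fromℕ _ , lookup-snoc-fromℕ zero π
HasZero-snoc (suc v) {π} (i , eq) =
  inject₁ i , trans (lookup-snoc-inject₁ (suc v) π i) (cong (punchIn (suc v)) eq)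

codes-HasZero : ∀ k n {πs} → πs ∈ codes k n → All HasZero πs
codes-HasZero k zero    (here refl) = replicated k
  where
  replicated : ∀ k → All HasZero (replicate k (zero ∷ []))
  replicated zero    = []
  replicated (suc k) = (zero , refl) ∷ replicated k
codes-HasZero k (suc n) πs∈ with ∈-cartesianProductWith⁻ (zipWith snoc) (words (allFin (suc (suc n))) k) (codes k n) πs∈
... | vs , πs , _ , πs∈codes , refl = zipped vs (codes-HasZero k n πs∈codes)
  where
  zipped : ∀ {k} (vs : Vec (Fin (suc (suc n))) k) {πs} → All HasZero πs → All HasZero (zipWith snoc vs πs)
  zipped []       []       = []
  zipped (v ∷ vs) {π ∷ _} (z ∷ zs) = HasZero-snoc v {π} z ∷ zipped vs zs

-- The letter `zero` of `π` survives `punchIn (suc v)`, and a record after it would have to be a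
-- letter below `zero`.
¬IsRecord-snoc-suc : ∀ {n} v {π : Vec (Fin (suc n)) (suc n)} → HasZero π →
                     ¬ IsRecord (fromℕ (suc n)) (snoc (suc v) π)
¬IsRecord-snoc-suc v {π} (i , eq) r = contradiction
  (subst₂ Fin._<_ (lookup-snoc-fromℕ (suc v) π)
                  (trans (lookup-snoc-inject₁ (suc v) π i) (cong (punchIn (suc v)) eq))
                  (r (inject₁ i) (inject₁<fromℕ i)))
  ℕ.n≮0

-- Each letter `zero` creates a record, so this is the record count of the appended position. The
-- type `Fin (suc k)` lets it index `c` directly; `inject₁` leaves the value unchanged.
zeros : ∀ {k n} → Vec (Fin (suc n)) k → Fin (suc k)
zeros []           = zero
zeros (zero  ∷ vs) = suc (zeros vs)
zeros (suc _ ∷ vs) = inject₁ (zeros vs)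

count-isRecord-inject₁ : ∀ {k n} (vs : Vec (Fin (suc n)) k) πs α →
  count (isRecord? (inject₁ α)) (zipWith snoc vs πs) ≡ count (isRecord? α) πs
count-isRecord-inject₁ []       []       α = refl
count-isRecord-inject₁ (v ∷ vs) (π ∷ πs) α = cong₂ (λ b m → (if b then suc else (λ i → i)) m)
  (does-⇔ (IsRecord-snoc-inject₁ v π α) (isRecord? (inject₁ α) (snoc v π)) (isRecord? α π))
  (count-isRecord-inject₁ vs πs α)

count-isRecord-fromℕ : ∀ {k n} (vs : Vec (Fin (suc (suc n))) k) {πs} → All HasZero πs →
  count (isRecord? (fromℕ (suc n))) (zipWith snoc vs πs) ≡ toℕ (zeros vs)
count-isRecord-fromℕ []           []       = refl
count-isRecord-fromℕ (zero  ∷ vs) {π ∷ _} (z ∷ zs)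
  rewrite dec-true (isRecord? (fromℕ _) (snoc zero π)) (IsRecord-snoc-zero π) =
  cong suc (count-isRecord-fromℕ vs zs)
count-isRecord-fromℕ (suc v ∷ vs) {π ∷ _} (z ∷ zs)
  rewrite dec-false (isRecord? (fromℕ _) (snoc (suc v) π)) (¬IsRecord-snoc-suc v {π} z) =
  trans (count-isRecord-fromℕ vs zs) (sym (toℕ-inject₁ (zeros vs)))

recordCount-inject₁ : ∀ {k n} (vs : Vec (Fin (suc n)) k) πs α →
  recordCount (zipWith snoc vs πs) (inject₁ α) ≡ recordCount πs α
recordCount-inject₁ vs πs α = toℕ-injective
  (trans (toℕ-fromℕ< _) (trans (count-isRecord-inject₁ vs πs α) (sym (toℕ-fromℕ< _))))

recordCount-fromℕ : ∀ {k n} (vs : Vec (Fin (suc (suc n))) k) {πs} → All HasZero πs →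
  recordCount (zipWith snoc vs πs) (fromℕ (suc n)) ≡ zeros vs
recordCount-fromℕ vs zs = toℕ-injective (trans (toℕ-fromℕ< _) (count-isRecord-fromℕ vs zs))

-- Cardinality unfolds from the front, while `snoc` adds a position at the back.
∣tabulate∣-last : ∀ {n} (f : Fin (suc n) → Bool) →
  ∣ tabulate f ∣ ≡ ∣ tabulate (f ∘ inject₁) ∣ ℕ.+ (if f (fromℕ n) then 1 else 0)
∣tabulate∣-last {zero}  f with f zero
... | true  = refl
... | false = refl
∣tabulate∣-last {suc n} f with f zero
... | true  = cong suc (∣tabulate∣-last (f ∘ suc))
... | false = ∣tabulate∣-last (f ∘ suc)

toℕ-Fin2 : ∀ (x : Fin 2) → (if does (x Fin.≟ suc zero) then 1 else 0) ≡ toℕ x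
toℕ-Fin2 zero       = refl
toℕ-Fin2 (suc zero) = refl

-- Old positions keep their record counts, and the new one has record count `zeros vs`. The weight
-- is thus additive along the construction of `codes`.
weight-snoc : ∀ {k n} (c : Fin (suc k) → Fin 2) (vs : Vec (Fin (suc (suc n))) k) {πs} → All HasZero πs →
  weight c (zipWith snoc vs πs) ≡ weight c πs ℕ.+ toℕ (c (zeros vs))
weight-snoc {n = n} c vs {πs} zs = begin
  weight c (zipWith snoc vs πs)
    ≡⟨ ∣tabulate∣-last (optimal ∘ recordCount (zipWith snoc vs πs)) ⟩
  ∣ tabulate (optimal ∘ recordCount (zipWith snoc vs πs) ∘ inject₁) ∣
    ℕ.+ (if optimal (recordCount (zipWith snoc vs πs) (fromℕ (suc n))) then 1 else 0)
    ≡⟨ cong₂ ℕ._+_ (cong ∣_∣ (tabulate-cong λ α → cong optimal (recordCount-inject₁ vs πs α)))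
                 (trans (cong (λ l → if optimal l then 1 else 0) (recordCount-fromℕ vs zs))
                        (toℕ-Fin2 (c (zeros vs)))) ⟩
  weight c πs ℕ.+ toℕ (c (zeros vs)) ∎
  where
  open ≡-Reasoning
  optimal : Fin _ → Bool
  optimal l = does (c l Fin.≟ suc zero)

-- The only position is a record of all k permutations. This is the source of the initial factor
-- x^(c_k).
weight-base : ∀ {k} (c : Fin (suc k) → Fin 2) →
  weight c (replicate k (zero {n = 0} ∷ [])) ≡ toℕ (c (fromℕ k))
weight-base {k} c = begin
  weight c ones                                     ≡⟨ ∣tabulate∣-last {0} (λ α → does (c (recordCount ones α) Fin.≟ suc zero)) ⟩
  (if does (c (recordCount ones zero) Fin.≟ suc zero) then 1 else 0) ≡⟨ toℕ-Fin2 _ ⟩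
  toℕ (c (recordCount ones zero))                   ≡⟨ cong (toℕ ∘ c) (toℕ-injective
    (trans (toℕ-fromℕ< _) (trans (count-ones k) (sym (toℕ-fromℕ k))))) ⟩
  toℕ (c (fromℕ k))                                 ∎
  where
  open ≡-Reasoning
  ones = replicate k (zero {n = 0} ∷ [])
  count-ones : ∀ k → count (isRecord? (zero {n = 0})) (replicate k (zero ∷ [])) ≡ k
  count-ones zero    = refl
  count-ones (suc k) = cong suc (count-ones k)

-- Rational arithmetic

-- An unnormalised fraction is a literal, unreduced pair with the denominator stored as its
-- predecessor; facts about `/` are checked there.
toℚᵘ-/ : ∀ a b → toℚᵘ (a / suc b) ℚᵘ.≃ mkℚᵘ a b
toℚᵘ-/ a b = toℚᵘ-fromℚᵘ (mkℚᵘ a b)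

/-* : ∀ a b c d .{{_ : NonZero b}} .{{_ : NonZero d}} →
      (+ a / b) * (+ c / d) ≡ _/_ (+ (a ℕ.* c)) (b ℕ.* d) {{ℕ.m*n≢0 b d}}
/-* a (suc b) c (suc d) = toℚᵘ-injective $ begin
  toℚᵘ ((+ a / suc b) * (+ c / suc d))            ≈⟨ toℚᵘ-homo-* (+ a / suc b) (+ c / suc d) ⟩
  toℚᵘ (+ a / suc b) ℚᵘ.* toℚᵘ (+ c / suc d)      ≈⟨ ℚᵘ.*-cong (toℚᵘ-/ (+ a) b) (toℚᵘ-/ (+ c) d) ⟩
  mkℚᵘ (+ a) b ℚᵘ.* mkℚᵘ (+ c) d                  ≈⟨ *≡* (cong (ℤ._* + (suc b ℕ.* suc d)) (sym (ℤ.pos-* a c))) ⟩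
  mkℚᵘ (+ (a ℕ.* c)) (d ℕ.+ b ℕ.* suc d)          ≈⟨ toℚᵘ-/ (+ (a ℕ.* c)) (d ℕ.+ b ℕ.* suc d) ⟨
  toℚᵘ (+ (a ℕ.* c) / (suc b ℕ.* suc d))          ∎
  where open ℚᵘ.≃-Reasoning

/-≤ : ∀ a b .{{_ : NonZero a}} .{{_ : NonZero b}} → a ℕ.≤ b → + 1 / b ≤ + 1 / a
/-≤ (suc a) (suc b) a≤b = toℚᵘ-cancel-≤ $ begin
  toℚᵘ (+ 1 / suc b)  ≃⟨ toℚᵘ-/ (+ 1) b ⟩
  mkℚᵘ (+ 1) b        ≤⟨ *≤* (ℤ.*-monoˡ-≤-nonNeg (+ 1) (ℤ.+≤+ a≤b)) ⟩
  mkℚᵘ (+ 1) a        ≃⟨ toℚᵘ-/ (+ 1) a ⟨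
  toℚᵘ (+ 1 / suc a)  ∎
  where open ℚᵘ.≤-Reasoning

n/n≡1 : ∀ n .{{_ : NonZero n}} → + n / n ≡ 1ℚ
n/n≡1 (suc n) = fromℚᵘ-cong {mkℚᵘ (+ suc n) n} {mkℚᵘ (+ 1) 0} (*≡* (ℤ.*-comm (+ suc n) (+ 1)))

fromℕℚ-+ : ∀ a b → fromℕℚ (a ℕ.+ b) ≡ fromℕℚ a + fromℕℚ b
fromℕℚ-+ a b = toℚᵘ-injective $ begin
  toℚᵘ (fromℕℚ (a ℕ.+ b))                  ≈⟨ toℚᵘ-/ _ 0 ⟩
  mkℚᵘ (+ (a ℕ.+ b)) 0                     ≈⟨ *≡* (cong (ℤ._* + 1)
    (sym (cong₂ ℤ._+_ (ℤ.*-identityʳ (+ a)) (ℤ.*-identityʳ (+ b))))) ⟩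
  mkℚᵘ (+ a) 0 ℚᵘ.+ mkℚᵘ (+ b) 0           ≈⟨ ℚᵘ.+-cong (toℚᵘ-/ (+ a) 0) (toℚᵘ-/ (+ b) 0) ⟨
  toℚᵘ (fromℕℚ a) ℚᵘ.+ toℚᵘ (fromℕℚ b)     ≈⟨ toℚᵘ-homo-+ (fromℕℚ a) (fromℕℚ b) ⟨
  toℚᵘ (fromℕℚ a + fromℕℚ b)               ∎
  where open ℚᵘ.≃-Reasoning

fromℕℚ-* : ∀ a b → fromℕℚ (a ℕ.* b) ≡ fromℕℚ a * fromℕℚ b
fromℕℚ-* a b = sym (/-* a 1 b 1)

fromℕℚ-suc : ∀ n → fromℕℚ (suc n) ≡ 1ℚ + fromℕℚ n
fromℕℚ-suc n = fromℕℚ-+ 1 n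

fromℕℚ-^ : ∀ a k → fromℕℚ (a ℕ.^ k) ≡ fromℕℚ a ^ k
fromℕℚ-^ a zero    = refl
fromℕℚ-^ a (suc k) = trans (fromℕℚ-* a (a ℕ.^ k)) (cong (fromℕℚ a *_) (fromℕℚ-^ a k))

n*1/n≡1 : ∀ n .{{_ : NonZero n}} → fromℕℚ n * (+ 1 / n) ≡ 1ℚ
n*1/n≡1 n {{n≢0}} = trans (/-* n 1 1 n)
  (trans (/-cong {{ℕ.m*n≢0 1 n}} {{n≢0}} (cong +_ (ℕ.*-identityʳ n)) (ℕ.*-identityˡ n)) (n/n≡1 n))

/≡*1/ : ∀ a b .{{_ : NonZero b}} → + a / b ≡ fromℕℚ a * (+ 1 / b)
/≡*1/ a b {{b≢0}} = sym (trans (/-* a 1 1 b)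
  (/-cong {{ℕ.m*n≢0 1 b}} {{b≢0}} (cong +_ (ℕ.*-identityʳ a)) (ℕ.*-identityˡ b)))

invPow-suc : ∀ d .{{_ : NonZero d}} β → fromℕℚ d * invPow d (suc β) ≡ invPow d β
invPow-suc d {{d≢0}} β = begin
  fromℕℚ d * invPow d (suc β)               ≡⟨ cong (fromℕℚ d *_) (sym (/-* 1 d 1 (d ℕ.^ β) {{d≢0}} {{ℕ.m^n≢0 d β}})) ⟩
  fromℕℚ d * ((+ 1 / d) * invPow d β)       ≡⟨ sym (*-assoc (fromℕℚ d) (+ 1 / d) (invPow d β)) ⟩
  fromℕℚ d * (+ 1 / d) * invPow d β         ≡⟨ cong (_* invPow d β) (n*1/n≡1 d) ⟩
  1ℚ * invPow d β                           ≡⟨ *-identityˡ _ ⟩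
  invPow d β                                ∎
  where open ≡-Reasoning

invPow-antitone : ∀ d .{{_ : NonZero d}} β → invPow (suc d) β ≤ invPow d β
invPow-antitone d β = /-≤ _ _ {{ℕ.m^n≢0 d β}} {{ℕ.m^n≢0 (suc d) β}} (ℕ.^-monoˡ-≤ β (ℕ.n≤1+n d))

0≤/ : ∀ a b .{{_ : NonZero b}} → 0ℚ ≤ + a / b
0≤/ a b = nonNegative⁻¹ (+ a / b) {{normalize-nonNeg a b}}

0≤+ : ∀ {p q} → 0ℚ ≤ p → 0ℚ ≤ q → 0ℚ ≤ p + q
0≤+ = +-mono-≤

*-monoˡ-≤ : ∀ {r} → 0ℚ ≤ r → ∀ {p q} → p ≤ q → r * p ≤ r * q
*-monoˡ-≤ {r} 0≤r = *-monoˡ-≤-nonNeg r {{nonNegative 0≤r}}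

*-monoʳ-≤ : ∀ {r} → 0ℚ ≤ r → ∀ {p q} → p ≤ q → p * r ≤ q * r
*-monoʳ-≤ {r} 0≤r = *-monoʳ-≤-nonNeg r {{nonNegative 0≤r}}

0≤* : ∀ {p q} → 0ℚ ≤ p → 0ℚ ≤ q → 0ℚ ≤ p * q
0≤* {p} {q} 0≤p 0≤q = subst (_≤ p * q) (*-zeroʳ p) (*-monoˡ-≤ 0≤p 0≤q)

0≤^ : ∀ {p} → 0ℚ ≤ p → ∀ n → 0ℚ ≤ p ^ n
0≤^ 0≤p zero    = 0≤/ 1 1
0≤^ 0≤p (suc n) = 0≤* 0≤p (0≤^ 0≤p n)

sum-mono-≤ : ∀ {n} {s t : Fin n → ℚ} → (∀ i → s i ≤ t i) → sum s ≤ sum t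
sum-mono-≤ {zero}  s≤t = ≤-refl
sum-mono-≤ {suc n} s≤t = +-mono-≤ (s≤t zero) (sum-mono-≤ (s≤t ∘ suc))

0≤sum : ∀ {n} {t : Fin n → ℚ} → (∀ i → 0ℚ ≤ t i) → 0ℚ ≤ sum t
0≤sum {zero}  0≤t = ≤-refl
0≤sum {suc n} 0≤t = 0≤+ (0≤t zero) (0≤sum (0≤t ∘ suc))

0≤product : ∀ {n} {t : Fin n → ℚ} → (∀ i → 0ℚ ≤ t i) → 0ℚ ≤ product t
0≤product {zero}  0≤t = 0≤/ 1 1
0≤product {suc n} 0≤t = 0≤* (0≤t zero) (0≤product (0≤t ∘ suc))

-- `sum` unfolds at index zero, whereas the induction on the number of factors adds the term of
-- highest index.
sum-toℕ-suc : ∀ (f : ℕ → ℚ) n → sum {suc n} (f ∘ toℕ) ≡ sum {n} (f ∘ toℕ) + f n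
sum-toℕ-suc f n = trans (sum-init-last {n} (f ∘ toℕ))
  (cong₂ _+_ (sum-cong-≗ {n} λ i → cong f (toℕ-inject₁ i)) (cong f (toℕ-fromℕ n)))

product-toℕ-suc : ∀ (f : ℕ → ℚ) n → product {suc n} (f ∘ toℕ) ≡ product {n} (f ∘ toℕ) * f n
product-toℕ-suc f n = trans (product-init-last {n} (f ∘ toℕ))
  (cong₂ _*_ (product-cong-≗ {n} λ i → cong f (toℕ-inject₁ i)) (cong f (toℕ-fromℕ n)))

-- Binomial sums and Pascal's rule

binomialSum : ∀ k → (Fin (suc k) → ℚ) → ℚ
binomialSum k t = sum λ β → fromℕℚ (k choose toℕ β) * t β

binomialSum-cong : ∀ k {s t} → (∀ β → s β ≡ t β) → binomialSum k s ≡ binomialSum k t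
binomialSum-cong k s≗t = sum-cong-≗ λ β → cong (fromℕℚ (k choose toℕ β) *_) (s≗t β)

binomialSum-* : ∀ k x t → binomialSum k (λ β → x * t β) ≡ x * binomialSum k t
binomialSum-* k x t = trans
  (sum-cong-≗ λ β → solve 3 (λ a x t → a :* (x :* t) := x :* (a :* t)) refl (fromℕℚ (k choose toℕ β)) x (t β))
  (sym (*-distribˡ-sum x λ β → fromℕℚ (k choose toℕ β) * t β))

binomialSum-+ : ∀ k s t → binomialSum k (λ β → s β + t β) ≡ binomialSum k s + binomialSum k t
binomialSum-+ k s t = trans
  (sum-cong-≗ λ β → *-distribˡ-+ (fromℕℚ (k choose toℕ β)) (s β) (t β))
  (∑-distrib-+ (λ β → fromℕℚ (k choose toℕ β) * s β) λ β → fromℕℚ (k choose toℕ β) * t β)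

-- Pascal's rule splits each coefficient in two. One part shifts the index; the other, joined with
-- the term at zero, runs over 0, ..., k + 1, and its top term vanishes because `k choose suc k` is
-- 0.
binomialSum-suc : ∀ k t → binomialSum (suc k) t ≡ binomialSum k (t ∘ suc) + binomialSum k (t ∘ inject₁)
binomialSum-suc k t = begin
  1ℚ * t zero + sum (λ β → fromℕℚ (suc k choose suc (toℕ β)) * t (suc β))
    ≡⟨ cong (_+_ (1ℚ * t zero)) (trans (sum-cong-≗ pascal) (∑-distrib-+ (λ β → fromℕℚ (k choose toℕ β) * t (suc β)) upper)) ⟩
  1ℚ * t zero + (binomialSum k (t ∘ suc) + sum upper)
    ≡⟨ solve 3 (λ x y z → x :+ (y :+ z) := y :+ (x :+ z)) refl (1ℚ * t zero) (binomialSum k (t ∘ suc)) (sum upper) ⟩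
  binomialSum k (t ∘ suc) + (1ℚ * t zero + sum upper)
    ≡⟨ cong (_+_ (binomialSum k (t ∘ suc))) (sum-init-last λ β → fromℕℚ (k choose toℕ β) * t β) ⟩
  binomialSum k (t ∘ suc) + (sum (λ β → fromℕℚ (k choose toℕ (inject₁ β)) * t (inject₁ β))
    + fromℕℚ (k choose toℕ (fromℕ (suc k))) * t (fromℕ (suc k)))
    ≡⟨ cong (_+_ (binomialSum k (t ∘ suc))) (cong₂ _+_
         (sum-cong-≗ {suc k} λ β → cong (λ l → fromℕℚ (k choose l) * t (inject₁ β)) (toℕ-inject₁ β))
         (trans (cong (λ a → fromℕℚ a * t (fromℕ (suc k))) last≡0) (*-zeroˡ (t (fromℕ (suc k)))))) ⟩
  binomialSum k (t ∘ suc) + (binomialSum k (t ∘ inject₁) + 0ℚ)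
    ≡⟨ cong (_+_ (binomialSum k (t ∘ suc))) (+-identityʳ _) ⟩
  binomialSum k (t ∘ suc) + binomialSum k (t ∘ inject₁) ∎
  where
  open ≡-Reasoning
  upper : Fin (suc k) → ℚ
  upper β = fromℕℚ (k choose suc (toℕ β)) * t (suc β)

  pascal : ∀ β → fromℕℚ (suc k choose suc (toℕ β)) * t (suc β) ≡ fromℕℚ (k choose toℕ β) * t (suc β) + upper β
  pascal β = trans
    (cong (_* t (suc β)) (trans (cong fromℕℚ (sym (nCk+nC[k+1]≡[n+1]C[k+1] k (toℕ β))))
                                (fromℕℚ-+ (k choose toℕ β) (k choose suc (toℕ β)))))
    (*-distribʳ-+ (t (suc β)) (fromℕℚ (k choose toℕ β)) (fromℕℚ (k choose suc (toℕ β))))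

  last≡0 : k choose toℕ (fromℕ (suc k)) ≡ 0
  last≡0 = k>n⇒nCk≡0 (ℕ.≤-reflexive (sym (toℕ-fromℕ (suc k))))

-- Sums over lists

∑ : ∀ {A : Set} → List A → (A → ℚ) → ℚ
∑ xs f = List.foldr (λ x s → f x + s) 0ℚ xs

-- Membership is kept in the hypothesis because the weight recursion requires `HasZero`, which is
-- derived from membership in `codes`.
∑-cong-∈ : ∀ {A : Set} (xs : List A) {f g} → (∀ {x} → x ∈ xs → f x ≡ g x) → ∑ xs f ≡ ∑ xs g
∑-cong-∈ List.[]       f≗g = refl
∑-cong-∈ (x List.∷ xs) f≗g = cong₂ _+_ (f≗g (here refl)) (∑-cong-∈ xs (f≗g ∘ there))

∑-cong : ∀ {A : Set} (xs : List A) {f g} → (∀ x → f x ≡ g x) → ∑ xs f ≡ ∑ xs g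
∑-cong xs f≗g = ∑-cong-∈ xs λ {x} _ → f≗g x

∑-++ : ∀ {A : Set} (xs ys : List A) f → ∑ (xs List.++ ys) f ≡ ∑ xs f + ∑ ys f
∑-++ List.[]       ys f = sym (+-identityˡ _)
∑-++ (x List.∷ xs) ys f = trans (cong (_+_ (f x)) (∑-++ xs ys f)) (sym (+-assoc (f x) _ _))

∑-map : ∀ {A B : Set} (g : A → B) xs f → ∑ (List.map g xs) f ≡ ∑ xs (f ∘ g)
∑-map g List.[]       f = refl
∑-map g (x List.∷ xs) f = cong (_+_ (f (g x))) (∑-map g xs f)

∑-cartesianProductWith : ∀ {A B C : Set} (g : A → B → C) xs ys f →
  ∑ (cartesianProductWith g xs ys) f ≡ ∑ xs λ x → ∑ ys λ y → f (g x y)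
∑-cartesianProductWith g List.[]       ys f = refl
∑-cartesianProductWith g (x List.∷ xs) ys f = trans
  (∑-++ (List.map (g x) ys) _ f)
  (cong₂ _+_ (∑-map (g x) ys f) (∑-cartesianProductWith g xs ys f))

∑-zero : ∀ {A : Set} (xs : List A) → ∑ xs (λ _ → 0ℚ) ≡ 0ℚ
∑-zero List.[]       = refl
∑-zero (x List.∷ xs) = trans (+-identityˡ _) (∑-zero xs)

∑-+ : ∀ {A : Set} (xs : List A) f g → ∑ xs (λ x → f x + g x) ≡ ∑ xs f + ∑ xs g
∑-+ List.[]       f g = refl
∑-+ (x List.∷ xs) f g = trans (cong (_+_ (f x + g x)) (∑-+ xs f g))
  (solve 4 (λ a b c d → (a :+ b) :+ (c :+ d) := (a :+ c) :+ (b :+ d)) refl (f x) (g x) (∑ xs f) (∑ xs g))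

∑-* : ∀ {A : Set} (xs : List A) a f → ∑ xs (λ x → a * f x) ≡ a * ∑ xs f
∑-* List.[]       a f = sym (*-zeroʳ a)
∑-* (x List.∷ xs) a f = trans (cong (_+_ (a * f x)) (∑-* xs a f)) (sym (*-distribˡ-+ a (f x) _))

∑-tabulate-const : ∀ {A : Set} n (g : Fin n → A) a → ∑ (List.tabulate g) (λ _ → a) ≡ fromℕℚ n * a
∑-tabulate-const zero    g a = sym (*-zeroˡ a)
∑-tabulate-const (suc n) g a = begin
  a + ∑ (List.tabulate (g ∘ suc)) (λ _ → a) ≡⟨ cong (_+_ a) (∑-tabulate-const n (g ∘ suc) a) ⟩
  a + fromℕℚ n * a                          ≡⟨ solve 2 (λ a n → a :+ n :* a := (con 1ℚ :+ n) :* a) refl a (fromℕℚ n) ⟩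
  (1ℚ + fromℕℚ n) * a                       ≡⟨ cong (_* a) (fromℕℚ-suc n) ⟨
  fromℕℚ (suc n) * a                        ∎
  where open ≡-Reasoning

∑-allFin-suc : ∀ n (f : Fin (suc n) → ℚ) a → (∀ i → f (suc i) ≡ a) → ∑ (allFin (suc n)) f ≡ f zero + fromℕℚ n * a
∑-allFin-suc n f a eq = cong (_+_ (f zero)) (trans (helper n suc eq) (∑-tabulate-const n suc a))
  where
  -- `suc` is generalised to an arbitrary `g` so that the induction along `List.tabulate` goes
  -- through.
  helper : ∀ m (g : Fin m → Fin (suc n)) → (∀ i → f (g i) ≡ a) → ∑ (List.tabulate g) f ≡ ∑ (List.tabulate g) (λ _ → a)
  helper zero    g eq = refl
  helper (suc m) g eq = cong₂ _+_ (eq zero) (helper m (g ∘ suc) (eq ∘ suc))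

length-filter : ∀ {A : Set} {P : A → Set} (P? : Decidable P) xs →
  fromℕℚ (length (filter P? xs)) ≡ ∑ xs λ x → if does (P? x) then 1ℚ else 0ℚ
length-filter P? List.[] = refl
length-filter P? (x List.∷ xs) with does (P? x)
... | true  = trans (fromℕℚ-suc (length (filter P? xs))) (cong (_+_ 1ℚ) (length-filter P? xs))
... | false = trans (length-filter P? xs) (sym (+-identityˡ _))

-- Induction on the word: a first letter `zero` raises the index by one, and each of the d other
-- letters keeps it, as in Pascal's rule. The power d^(k-l) is written as d^k / d^l so that d = j -
-- 1 gives the summands of `F j`.
∑-words-zeros : ∀ d .{{_ : NonZero d}} k (φ : Fin (suc k) → ℚ) →
  ∑ (words (allFin (suc d)) k) (φ ∘ zeros) ≡ fromℕℚ d ^ k * binomialSum k λ l → φ l * invPow d (toℕ l)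
∑-words-zeros d zero    φ = solve 1 (λ x → x :+ con 0ℚ := con 1ℚ :* (con 1ℚ :* (x :* con 1ℚ) :+ con 0ℚ)) refl (φ zero)
∑-words-zeros d (suc k) φ = begin
  ∑ (words (allFin (suc d)) (suc k)) (φ ∘ zeros)
    ≡⟨ ∑-cartesianProductWith _∷_ (allFin (suc d)) (words (allFin (suc d)) k) (φ ∘ zeros) ⟩
  ∑ (allFin (suc d)) (λ v → ∑ ws λ vs → φ (zeros (v ∷ vs)))
    ≡⟨ ∑-allFin-suc d (λ v → ∑ ws λ vs → φ (zeros (v ∷ vs))) (∑ ws (φ ∘ inject₁ ∘ zeros)) (λ _ → refl) ⟩
  ∑ ws (φ ∘ suc ∘ zeros) + D * ∑ ws (φ ∘ inject₁ ∘ zeros)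
    ≡⟨ cong₂ (λ a b → a + D * b) (∑-words-zeros d k (φ ∘ suc)) (∑-words-zeros d k (φ ∘ inject₁)) ⟩
  D ^ k * binomialSum k (λ l → φ (suc l) * invPow d (toℕ l)) + D * (D ^ k * binomialSum k λ l → φ (inject₁ l) * invPow d (toℕ l))
    ≡⟨ cong₂ (λ a b → D ^ k * a + D * (D ^ k * b))
         (trans (binomialSum-cong k scale) (binomialSum-* k D (t ∘ suc)))
         (binomialSum-cong k λ l → cong (λ i → φ (inject₁ l) * invPow d i) (sym (toℕ-inject₁ l))) ⟩
  D ^ k * (D * binomialSum k (t ∘ suc)) + D * (D ^ k * binomialSum k (t ∘ inject₁))
    ≡⟨ solve 4 (λ D E x y → E :* (D :* x) :+ D :* (E :* y) := (D :* E) :* (x :+ y)) refl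
         D (D ^ k) (binomialSum k (t ∘ suc)) (binomialSum k (t ∘ inject₁)) ⟩
  D ^ suc k * (binomialSum k (t ∘ suc) + binomialSum k (t ∘ inject₁))
    ≡⟨ cong (D ^ suc k *_) (sym (binomialSum-suc k t)) ⟩
  D ^ suc k * binomialSum (suc k) t ∎
  where
  open ≡-Reasoning
  ws = words (allFin (suc d)) k
  D = fromℕℚ d

  t : Fin (suc (suc k)) → ℚ
  t l = φ l * invPow d (toℕ l)

  -- The branch of the letter `zero` carries only d^k in front; the missing d is drawn from 1/d^l =
  -- d / d^(l+1).
  scale : ∀ l → φ (suc l) * invPow d (toℕ l) ≡ D * t (suc l)
  scale l = trans (cong (φ (suc l) *_) (sym (invPow-suc d (toℕ l))))
    (solve 3 (λ x D y → x :* (D :* y) := D :* (x :* y)) refl (φ (suc l)) D (invPow d (suc (toℕ l))))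

-- The weight enumerator

-- Multiplication by x on sequences of coefficients.
prev : (ℕ → ℚ) → ℕ → ℚ
prev p zero    = 0ℚ
prev p (suc w) = p w

-- The coefficients of the monomial x^a. The test `≡ᵇ` is what `does (a ℕ.≟ w)` computes to, so
-- `length-filter` yields `N` by computation.
δ : ℕ → ℕ → ℚ
δ a w = if a ≡ᵇ w then 1ℚ else 0ℚ

δ-suc : ∀ a w → δ (suc a) w ≡ prev (δ a) w
δ-suc a zero    = refl
δ-suc a (suc w) = refl

-- For x in {0, 1} this selects `a` or `b`. The affine form commutes with sums and separates C' from
-- C.
choice : ℚ → ℚ → ℚ → ℚ
choice x a b = (1ℚ - x) * a + x * b

δ-choice : ∀ a (x : Fin 2) w → δ (a ℕ.+ toℕ x) w ≡ choice (fromℕℚ (toℕ x)) (δ a w) (prev (δ a) w)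
δ-choice a zero w = trans (cong (λ a → δ a w) (ℕ.+-identityʳ a))
  (solve 2 (λ x y → x := (con 1ℚ :- con 0ℚ) :* x :+ con 0ℚ :* y) refl (δ a w) (prev (δ a) w))
δ-choice a (suc zero) w = trans (trans (cong (λ a → δ a w) (ℕ.+-comm a 1)) (δ-suc a w))
  (solve 2 (λ x y → y := (con 1ℚ :- con 1ℚ) :* x :+ con 1ℚ :* y) refl (δ a w) (prev (δ a) w))

∑-prev : ∀ {A : Set} (xs : List A) (f : A → ℕ → ℚ) w → ∑ xs (λ x → prev (f x) w) ≡ prev (λ w → ∑ xs λ x → f x w) w
∑-prev xs f zero    = ∑-zero xs
∑-prev xs f (suc w) = refl

∑-choice : ∀ {A : Set} (xs : List A) x f g → ∑ xs (λ y → choice x (f y) (g y)) ≡ choice x (∑ xs f) (∑ xs g)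
∑-choice xs x f g = trans (∑-+ xs (λ y → (1ℚ - x) * f y) (λ y → x * g y)) (cong₂ _+_ (∑-* xs (1ℚ - x) f) (∑-* xs x g))

-- The coefficient of x^w in the weight enumerator of `codes k n`, whose words have n + 1 letters.
N : ∀ {k} → (Fin (suc k) → Fin 2) → ℕ → ℕ → ℚ
N {k} c n w = ∑ (codes k n) λ πs → δ (weight c πs) w

O≤N : ∀ {k} (c : Fin (suc k) → Fin 2) n w → fromℕℚ (O c (suc n) w) ≤ N c n w
O≤N {k} c n w = ≤-trans (fromℕℚ-mono (O≤length-codes c n w))
  (≤-reflexive (length-filter (λ πs → weight c πs ℕ.≟ w) (codes k n)))
  where
  fromℕℚ-mono : ∀ {a b} → a ℕ.≤ b → fromℕℚ a ≤ fromℕℚ b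
  fromℕℚ-mono {a} {b} a≤b = subst₂ _≤_ (+-identityʳ _)
    (trans (sym (fromℕℚ-+ a (b ∸ a))) (cong fromℕℚ (ℕ.m+[n∸m]≡n a≤b)))
    (+-monoʳ-≤ (fromℕℚ a) (0≤/ (b ∸ a) 1))

-- coeff f g s n w is the coefficient of x^w in x^s ∏_{i<n} (f i + g i x).
coeff : (f g : ℕ → ℚ) (s n : ℕ) → ℕ → ℚ
coeff f g s zero    w = δ s w
coeff f g s (suc n) w = f n * coeff f g s n w + g n * prev (coeff f g s n) w

module _ {k} (c : Fin (suc k) → Fin 2) where

  -- The index n stands for j = n + 2, the passage from n + 1 to n + 2 letters.
  F₀ F₁ : ℕ → ℚ
  F₀ n = F (suc (suc n)) (complement (toℚ c))
  F₁ n = F (suc (suc n)) (toℚ c)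

  binomialSum-choice : ∀ n a b →
    binomialSum k (λ l → choice (toℚ c l) a b * invPow (suc n) (toℕ l)) ≡ F₀ n * a + F₁ n * b
  binomialSum-choice n a b = begin
    binomialSum k (λ l → choice (toℚ c l) a b * i l)
      ≡⟨ binomialSum-cong k (λ l → solve 4 (λ x a b i → ((con 1ℚ :- x) :* a :+ x :* b) :* i
           := a :* ((con 1ℚ :- x) :* i) :+ b :* (x :* i)) refl (toℚ c l) a b (i l)) ⟩
    binomialSum k (λ l → a * (complement (toℚ c) l * i l) + b * (toℚ c l * i l))
      ≡⟨ binomialSum-+ k (λ l → a * (complement (toℚ c) l * i l)) (λ l → b * (toℚ c l * i l)) ⟩
    _ ≡⟨ cong₂ _+_ (binomialSum-* k a λ l → complement (toℚ c) l * i l) (binomialSum-* k b λ l → toℚ c l * i l) ⟩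
    -- Both binomial sums are values of `F` by definition.
    a * F₀ n + b * F₁ n
      ≡⟨ cong₂ _+_ (*-comm a (F₀ n)) (*-comm b (F₁ n)) ⟩
    F₀ n * a + F₁ n * b ∎
    where
    open ≡-Reasoning
    i : Fin (suc k) → ℚ
    i l = invPow (suc n) (toℕ l)

  N-zero : ∀ w → N c 0 w ≡ δ (toℕ (c (fromℕ k))) w
  N-zero w = trans (+-identityʳ _) (cong (λ a → δ a w) (weight-base c))

  N-suc : ∀ n w → N c (suc n) w ≡ fromℕℚ (suc n) ^ k * (F₀ n * N c n w + F₁ n * prev (N c n) w)
  N-suc n w = begin
    N c (suc n) w
      ≡⟨ ∑-cartesianProductWith (zipWith snoc) ws (codes k n) (λ πs → δ (weight c πs) w) ⟩
    ∑ ws (λ vs → ∑ (codes k n) λ πs → δ (weight c (zipWith snoc vs πs)) w)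
      -- For fixed `vs` every weight grows by the same amount, so the inner sum is the old
      -- coefficient or its shift. What is left depends on `vs` only through `zeros vs`.
      ≡⟨ ∑-cong ws (λ vs → trans
           (∑-cong-∈ (codes k n) λ {πs} πs∈ → trans
             (cong (λ a → δ a w) (weight-snoc c vs (codes-HasZero k n πs∈)))
             (δ-choice (weight c πs) (c (zeros vs)) w))
           (trans (∑-choice (codes k n) (toℚ c (zeros vs)) _ _)
                  (cong (choice (toℚ c (zeros vs)) (N c n w)) (∑-prev (codes k n) (δ ∘ weight c) w)))) ⟩
    ∑ ws (λ vs → choice (toℚ c (zeros vs)) (N c n w) (prev (N c n) w))
      ≡⟨ ∑-words-zeros (suc n) k (λ l → choice (toℚ c l) (N c n w) (prev (N c n) w)) ⟩
    fromℕℚ (suc n) ^ k * binomialSum k (λ l → choice (toℚ c l) (N c n w) (prev (N c n) w) * invPow (suc n) (toℕ l))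
      ≡⟨ cong (fromℕℚ (suc n) ^ k *_) (binomialSum-choice n (N c n w) (prev (N c n) w)) ⟩
    fromℕℚ (suc n) ^ k * (F₀ n * N c n w + F₁ n * prev (N c n) w) ∎
    where
    open ≡-Reasoning
    ws = words (allFin (suc (suc n))) k

  -- The factors d^k of the single steps, for d = 1, ..., n, multiply to (n!)^k.
  N≡coeff : ∀ n w → N c n w ≡ fromℕℚ (n !) ^ k * coeff F₀ F₁ (toℕ (c (fromℕ k))) n w
  N≡coeff zero w = trans (N-zero w) (sym (trans (cong (_* coeff F₀ F₁ (toℕ (c (fromℕ k))) 0 w) (1^ k)) (*-identityˡ _)))
    where
    1^ : ∀ k → 1ℚ ^ k ≡ 1ℚ
    1^ zero    = refl
    1^ (suc k) = trans (*-identityˡ _) (1^ k)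
  N≡coeff (suc n) w = begin
    N c (suc n) w
      ≡⟨ N-suc n w ⟩
    D * (F₀ n * N c n w + F₁ n * prev (N c n) w)
      ≡⟨ cong₂ (λ a b → D * (F₀ n * a + F₁ n * b)) (N≡coeff n w) (prev-eq w) ⟩
    D * (F₀ n * (P * e w) + F₁ n * (P * prev e w))
      ≡⟨ solve 6 (λ D P f a g b → D :* (f :* (P :* a) :+ g :* (P :* b)) := (D :* P) :* (f :* a :+ g :* b)) refl
           D P (F₀ n) (e w) (F₁ n) (prev e w) ⟩
    (D * P) * coeff F₀ F₁ s (suc n) w
      ≡⟨ cong (_* coeff F₀ F₁ s (suc n) w) (sym (trans (cong (_^ k) (fromℕℚ-* (suc n) (n !)))
           (^-distrib-* (fromℕℚ (suc n)) (fromℕℚ (n !)) k))) ⟩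
    fromℕℚ (suc n !) ^ k * coeff F₀ F₁ s (suc n) w ∎
    where
    open ≡-Reasoning
    s = toℕ (c (fromℕ k))
    D = fromℕℚ (suc n) ^ k
    P = fromℕℚ (n !) ^ k
    e = coeff F₀ F₁ s n
    prev-eq : ∀ w → prev (N c n) w ≡ P * prev e w
    prev-eq zero    = sym (*-zeroʳ P)
    prev-eq (suc w) = N≡coeff n w

-- Bounds for the coefficients

coeff-suc : ∀ f g s n w → coeff f g (suc s) n w ≡ prev (coeff f g s n) w
coeff-suc f g s zero    w       = δ-suc s w
coeff-suc f g s (suc n) zero    = trans (cong (λ a → f n * a + g n * 0ℚ) (coeff-suc f g s n zero))
  (solve 2 (λ f g → f :* con 0ℚ :+ g :* con 0ℚ := con 0ℚ) refl (f n) (g n))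
coeff-suc f g s (suc n) (suc w) = cong₂ (λ a b → f n * a + g n * b) (coeff-suc f g s n (suc w)) (coeff-suc f g s n w)

-- The factor x^s only shifts the coefficients; this passes from weight m - 1 + c_k to degree m - 1.
coeff-shift : ∀ f g s n r → coeff f g s n (r ℕ.+ s) ≡ coeff f g 0 n r
coeff-shift f g zero    n r = cong (coeff f g 0 n) (ℕ.+-identityʳ r)
coeff-shift f g (suc s) n r = trans (cong (coeff f g (suc s) n) (ℕ.+-suc r s))
  (trans (coeff-suc f g s n (suc (r ℕ.+ s))) (coeff-shift f g s n r))

-- The left side consists of the first two terms of the binomial expansion. Multiplying the
-- induction hypothesis by `x + y` gives the next two and the nonnegative extra term
-- `R * (y * y * X)`.
bernoulli : ∀ {x y} → 0ℚ ≤ x → 0ℚ ≤ y → ∀ r → x ^ suc r + fromℕℚ (suc r) * y * x ^ r ≤ (x + y) ^ suc r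
bernoulli {x} {y} 0≤x 0≤y zero =
  ≤-reflexive (solve 2 (λ x y → x :* con 1ℚ :+ con 1ℚ :* y :* con 1ℚ := (x :+ y) :* con 1ℚ) refl x y)
bernoulli {x} {y} 0≤x 0≤y (suc r) = begin
  x * (x * X) + fromℕℚ (suc (suc r)) * y * (x * X)
    ≡⟨ cong (λ a → x * (x * X) + a * y * (x * X)) (fromℕℚ-suc (suc r)) ⟩
  x * (x * X) + (1ℚ + R) * y * (x * X)
    ≡⟨ +-identityʳ _ ⟨
  x * (x * X) + (1ℚ + R) * y * (x * X) + 0ℚ
    ≤⟨ +-monoʳ-≤ (x * (x * X) + (1ℚ + R) * y * (x * X)) (0≤* 0≤R (0≤* (0≤* 0≤y 0≤y) (0≤^ 0≤x r))) ⟩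
  x * (x * X) + (1ℚ + R) * y * (x * X) + R * (y * y * X)
    ≡⟨ solve 4 (λ x y R X → x :* (x :* X) :+ (con 1ℚ :+ R) :* y :* (x :* X) :+ R :* (y :* y :* X)
         := (x :+ y) :* (x :* X :+ R :* y :* X)) refl x y R X ⟩
  (x + y) * (x * X + R * y * X)
    ≤⟨ *-monoˡ-≤ (0≤+ 0≤x 0≤y) (bernoulli 0≤x 0≤y r) ⟩
  (x + y) ^ suc (suc r) ∎
  where
  open ℚ.≤-Reasoning
  X = x ^ r
  R = fromℕℚ (suc r)
  0≤R : 0ℚ ≤ R
  0≤R = 0≤/ (suc r) 1

-- A product of n linear factors has degree at most n.
coeff≡0 : ∀ f g {n r} → n ℕ.< r → coeff f g 0 n r ≡ 0ℚ
coeff≡0 f g {zero}  {suc r} _         = refl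
coeff≡0 f g {suc n} {suc r} (s≤s n<r) = trans
  (cong₂ (λ a b → f n * a + g n * b) (coeff≡0 f g (ℕ.m<n⇒m<1+n n<r)) (coeff≡0 f g n<r))
  (solve 2 (λ f g → f :* con 0ℚ :+ g :* con 0ℚ := con 0ℚ) refl (f n) (g n))

antitone : ∀ {f : ℕ → ℚ} → (∀ n → f (suc n) ≤ f n) → ∀ {m n} → m ℕ.≤ n → f n ≤ f m
antitone {f} f↓ m≤n = go (ℕ.≤⇒≤′ m≤n)
  where
  go : ∀ {m n} → m ℕ.≤′ n → f n ≤ f m
  go ℕ.≤′-refl       = ≤-refl
  go (ℕ.≤′-step m≤n) = ≤-trans (f↓ _) (go m≤n)

module _ {f g : ℕ → ℚ} (0≤f : ∀ n → 0ℚ ≤ f n) (0≤g : ∀ n → 0ℚ ≤ g n) (f↓ : ∀ n → f (suc n) ≤ f n) where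

  -- Induction on n, by the choice of `f n` or `g n` from the last factor. Choosing `g n` lowers the
  -- degree and splits r + 1 off (r + 1)!. Both choices are bounded by multiples of the same product
  -- `Π`, and `bernoulli` joins them into the power of `G + g n`.
  coeff-bound : ∀ n r → r ℕ.≤ n →
    fromℕℚ (r !) * coeff f g 0 n r ≤ sum {n} (g ∘ toℕ) ^ r * product {n ∸ r} (f ∘ toℕ)
  coeff-bound zero    zero    _ = ≤-refl
  coeff-bound (suc n) zero    _ = begin
    1ℚ * (f n * e + g n * 0ℚ)
      ≡⟨ solve 3 (λ f e g → con 1ℚ :* (f :* e :+ g :* con 0ℚ) := f :* (con 1ℚ :* e)) refl (f n) e (g n) ⟩
    f n * (1ℚ * e)
      ≤⟨ *-monoˡ-≤ (0≤f n) (coeff-bound n zero z≤n) ⟩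
    f n * (1ℚ * product {n} (f ∘ toℕ))
      ≡⟨ solve 2 (λ f p → f :* (con 1ℚ :* p) := con 1ℚ :* (p :* f)) refl (f n) (product {n} (f ∘ toℕ)) ⟩
    1ℚ * (product {n} (f ∘ toℕ) * f n)
      ≡⟨ cong (1ℚ *_) (product-toℕ-suc f n) ⟨
    1ℚ * product {suc n} (f ∘ toℕ) ∎
    where
    open ℚ.≤-Reasoning
    e = coeff f g 0 n 0
  coeff-bound (suc n) (suc r) (s≤s r≤n) = begin
    fromℕℚ (suc r !) * (f n * e₁ + g n * e₀)
      ≡⟨ *-distribˡ-+ (fromℕℚ (suc r !)) _ _ ⟩
    fromℕℚ (suc r !) * (f n * e₁) + fromℕℚ (suc r !) * (g n * e₀)
      ≡⟨ cong₂ _+_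
           (solve 3 (λ a b c → a :* (b :* c) := b :* (a :* c)) refl (fromℕℚ (suc r !)) (f n) e₁)
           (trans (cong (_* (g n * e₀)) (fromℕℚ-* (suc r) (r !)))
             (solve 4 (λ a b c d → (a :* b) :* (c :* d) := (a :* c) :* (b :* d)) refl R (fromℕℚ (r !)) (g n) e₀)) ⟩
    f n * (fromℕℚ (suc r !) * e₁) + (R * g n) * (fromℕℚ (r !) * e₀)
      ≤⟨ +-mono-≤ first (*-monoˡ-≤ (0≤* (0≤/ (suc r) 1) (0≤g n)) (coeff-bound n r r≤n)) ⟩
    G ^ suc r * Π + (R * g n) * (G ^ r * Π)
      ≡⟨ solve 4 (λ a b c p → a :* p :+ b :* (c :* p) := (a :+ b :* c) :* p) refl (G ^ suc r) (R * g n) (G ^ r) Π ⟩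
    (G ^ suc r + R * g n * G ^ r) * Π
      ≤⟨ *-monoʳ-≤ 0≤Π (bernoulli 0≤G (0≤g n) r) ⟩
    (G + g n) ^ suc r * Π
      ≡⟨ cong (λ a → a ^ suc r * Π) (sum-toℕ-suc g n) ⟨
    sum {suc n} (g ∘ toℕ) ^ suc r * Π ∎
    where
    open ℚ.≤-Reasoning
    e₁ = coeff f g 0 n (suc r)
    e₀ = coeff f g 0 n r
    G = sum {n} (g ∘ toℕ)
    Π = product {n ∸ r} (f ∘ toℕ)
    R = fromℕℚ (suc r)
    0≤G : 0ℚ ≤ G
    0≤G = 0≤sum {n} (0≤g ∘ toℕ)
    0≤Π : 0ℚ ≤ Π
    0≤Π = 0≤product {n ∸ r} (0≤f ∘ toℕ)

    -- When r < n, the factor f n is exchanged for the larger f (n ∸ suc r).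
    first : f n * (fromℕℚ (suc r !) * e₁) ≤ G ^ suc r * Π
    first with ℕ.m≤n⇒m<n∨m≡n r≤n
    ... | inj₁ r<n = begin
      f n * (fromℕℚ (suc r !) * e₁)
        ≤⟨ *-monoˡ-≤ (0≤f n) (coeff-bound n (suc r) r<n) ⟩
      f n * (G ^ suc r * Π′)
        ≤⟨ *-monoʳ-≤ (0≤* (0≤^ 0≤G (suc r)) (0≤product {n ∸ suc r} (0≤f ∘ toℕ))) (antitone f↓ (ℕ.m∸n≤m n (suc r))) ⟩
      f (n ∸ suc r) * (G ^ suc r * Π′)
        ≡⟨ solve 3 (λ a b c → a :* (b :* c) := b :* (c :* a)) refl (f (n ∸ suc r)) (G ^ suc r) Π′ ⟩
      G ^ suc r * (Π′ * f (n ∸ suc r))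
        ≡⟨ cong (G ^ suc r *_) (product-toℕ-suc f (n ∸ suc r)) ⟨
      G ^ suc r * product {suc (n ∸ suc r)} (f ∘ toℕ)
        -- `suc n ∸ suc r` computes to `n ∸ r`, the number of factors in `Π`.
        ≡⟨ cong (λ m → G ^ suc r * product {m} (f ∘ toℕ)) (sym (ℕ.+-∸-assoc 1 r<n)) ⟩
      G ^ suc r * Π ∎
      where Π′ = product {n ∸ suc r} (f ∘ toℕ)
    -- Here r = n, and n factors have no term of degree n + 1.
    ... | inj₂ refl = begin
      f n * (fromℕℚ (suc r !) * e₁)   ≡⟨ cong (λ a → f n * (fromℕℚ (suc r !) * a)) (coeff≡0 f g (ℕ.n<1+n n)) ⟩
      f n * (fromℕℚ (suc r !) * 0ℚ)   ≡⟨ solve 2 (λ a b → a :* (b :* con 0ℚ) := con 0ℚ) refl (f n) (fromℕℚ (suc r !)) ⟩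
      0ℚ                              ≤⟨ 0≤* (0≤^ 0≤G (suc r)) 0≤Π ⟩
      G ^ suc r * Π                   ∎

-- Monotonicity in j and summation of the F_j

module _ {k} {x : Fin (suc k) → ℚ} (0≤x : ∀ β → 0ℚ ≤ x β) where

  0≤F : ∀ n → 0ℚ ≤ F (suc (suc n)) x
  0≤F n = 0≤sum λ β → 0≤* (0≤/ (k choose toℕ β) 1) (0≤* (0≤x β) (0≤/ 1 _ {{ℕ.m^n≢0 (suc n) (toℕ β)}}))

  -- Termwise: 1/(j-1)^β is nonincreasing in j, and its coefficients are nonnegative.
  F-antitone : ∀ n → F (suc (suc (suc n))) x ≤ F (suc (suc n)) x
  F-antitone n = sum-mono-≤ λ β →
    *-monoˡ-≤ (0≤/ (k choose toℕ β) 1) (*-monoˡ-≤ (0≤x β) (invPow-antitone (suc n) (toℕ β)))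

-- The summations over β and j are interchanged. The term of `H` at `t` is a power of 1/(t+1), and t
-- + 1 = j - 1 for j = t + 2.
H·≡sum-F : ∀ {k} n (x : Fin (suc k) → ℚ) → H k (suc n) · x ≡ sum {n} λ t → F (suc (suc (toℕ t))) x
H·≡sum-F {k} n x = trans (sum-cong-≗ column)
  (∑-comm {suc k} {n} λ β t → fromℕℚ (k choose toℕ β) * (x β * invPow (suc (toℕ t)) (toℕ β)))
  where
  column : ∀ β → H k (suc n) β * x β ≡ sum {n} λ t → fromℕℚ (k choose toℕ β) * (x β * invPow (suc (toℕ t)) (toℕ β))
  column β = begin
    a * sum i * x β               ≡⟨ solve 3 (λ a s x → a :* s :* x := a :* (x :* s)) refl a (sum i) (x β) ⟩
    a * (x β * sum i)             ≡⟨ cong (a *_) (*-distribˡ-sum (x β) i) ⟩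
    a * sum (λ t → x β * i t)     ≡⟨ *-distribˡ-sum a (λ t → x β * i t) ⟩
    sum (λ t → a * (x β * i t))   ∎
    where
    open ≡-Reasoning
    a = fromℕℚ (k choose toℕ β)
    i : Fin n → ℚ
    i t = invPow (suc (toℕ t)) (toℕ β)

0≤complement : ∀ {k} (c : Fin (suc k) → Fin 2) β → 0ℚ ≤ complement (toℚ c) β
0≤complement c β with c β
... | zero     = 0≤/ 1 1
... | suc zero = 0≤/ 0 1

coeff-F-bound : ∀ {k} (c : Fin (suc k) → Fin 2) n r → r ℕ.≤ n →
  fromℕℚ (r !) * coeff (F₀ c) (F₁ c) 0 n r ≤ (H k (suc n) · toℚ c) ^ r * product {n ∸ r} (F₀ c ∘ toℕ)
coeff-F-bound {k} c n r r≤n = subst (λ G → fromℕℚ (r !) * coeff (F₀ c) (F₁ c) 0 n r ≤ G ^ r * product {n ∸ r} (F₀ c ∘ toℕ))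
  (sym (H·≡sum-F n (toℚ c)))
  (coeff-bound (0≤F (0≤complement c)) (0≤F λ β → 0≤/ (toℕ (c β)) 1) (F-antitone (0≤complement c)) n r r≤n)

theorem5p1 : (k n : ℕ) → 1 ℕ.≤ k → 2 ℕ.≤ n → (c : Vector (Fin 2) (suc k)) →
    (m : ℕ) → 1 ℕ.≤ m → m ℕ.≤ n →
    Omax c n m ≥ fromℕℚ (O c n (m ℕ.+ toℕ (c (fromℕ k)) ∸ 1))
theorem5p1 k (suc n) _ _ c (suc r) _ (s≤s r≤n) = begin
  -- With m = r + 1, the weight `suc r ℕ.+ s ∸ 1` computes to `r ℕ.+ s`.
  fromℕℚ (O c (suc n) (r ℕ.+ s))       ≤⟨ O≤N c n (r ℕ.+ s) ⟩
  N c n (r ℕ.+ s)                      ≡⟨ N≡coeff c n (r ℕ.+ s) ⟩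
  P * coeff (F₀ c) (F₁ c) s n (r ℕ.+ s)  ≡⟨ cong (P *_) (coeff-shift (F₀ c) (F₁ c) s n r) ⟩
  P * e                                ≡⟨ cong (P *_) (*-identityˡ e) ⟨
  -- The inserted 1 is r! times 1/r!: the first factor gives the left side of `coeff-F-bound`, the
  -- second the denominator in `Omax`.
  P * (1ℚ * e)                         ≡⟨ cong (λ a → P * (a * e)) (n*1/n≡1 (r !) {{r ℕ.!≢0}}) ⟨
  P * (fromℕℚ (r !) * u * e)           ≡⟨ solve 4
    (λ P a u e → P :* (a :* u :* e) := (P :* u) :* (a :* e)) refl P (fromℕℚ (r !)) u e ⟩
  (P * u) * (fromℕℚ (r !) * e)         ≤⟨ *-monoˡ-≤
    (0≤* (0≤^ (0≤/ (n !) 1) k) (0≤/ 1 (r !) {{r ℕ.!≢0}})) (coeff-F-bound c n r r≤n) ⟩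
  (P * u) * (h * Π)                    ≡⟨ *-assoc (P * u) h Π ⟨
  P * u * h * Π                        ≡⟨ cong (λ a → a * h * Π)
    (trans (cong (_* u) (sym (fromℕℚ-^ (n !) k))) (sym (/≡*1/ ((n !) ℕ.^ k) (r !) {{r ℕ.!≢0}}))) ⟩
  Omax c (suc n) (suc r)               ∎
  where
  open ℚ.≤-Reasoning
  s = toℕ (c (fromℕ k))
  P = fromℕℚ (n !) ^ k
  u = _/_ (+ 1) (r !) {{r ℕ.!≢0}}
  e = coeff (F₀ c) (F₁ c) 0 n r
  h = (H k (suc n) · toℚ c) ^ r
  Π = product {n ∸ r} (F₀ c ∘ toℕ)
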